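{- There is an absolute constant $C$ such that for every connected $3$-colorable graph $G$ of order $n$ and minimum degree at least $\delta\ge 1$, \[ \operatorname{diam}(G)\le \frac{57n}{23\delta}+C. \]
   Context: $\operatorname{diam}(G)$ is the diameter of $G$. The paper writes the additive term as $O(1)$. -}

module Defs where

open import Data.Nat using (ℕ; zero; suc; _+_; _*_; _≤_)
open import Data.Fin using (Fin)
open import Data.Bool using (Bool; true; false)
open import Data.List using (List; filter; length; allFin)
open import Data.Product using (Σ; ∃; _×_; _,_)
open import Relation.Binary.PropositionalEquality using (_≡_; _≢_)
open import Relation.Nullary using (¬_)
open import Data.Bool.Properties using (_≟_)

record Graph (n : ℕ) : Set where
  field
    adj   : Fin n → Fin n → Bool
    sym   : ∀ u v → adj u v ≡ adj v u
    irrefl : ∀ v → adj v v ≡ false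
open Graph public

degree : ∀ {n} → Graph n → Fin n → ℕ
degree {n} G v = length (filter (λ w → adj G v w ≟ true) (allFin n))

MinDegreeAtLeast : ∀ {n} → Graph n → ℕ → Set
MinDegreeAtLeast G δ = ∀ v → δ ≤ degree G v

data Walk {n : ℕ} (G : Graph n) : Fin n → Fin n → ℕ → Set where
  here : ∀ {u} → Walk G u u 0
  step : ∀ {u w v k} → adj G u w ≡ true → Walk G w v k → Walk G u v (suc k)

Connected : ∀ {n} → Graph n → Set
Connected G = ∀ u v → ∃ λ k → Walk G u v k

Colorable : ∀ {n} → ℕ → Graph n → Set
Colorable {n} k G = Σ (Fin n → Fin k) λ c → ∀ u v → adj G u v ≡ true → c u ≢ c v

module Submission where

{-
Fix v and let A_j(c) be the number of vertices of colour c at distance j − 1 from v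
(so A_0 = 0).  The neighbours of a vertex of colour c in layer j + 1 lie in layers j,
j + 1, j + 2 and have other colours, hence A_{j+1}(c) > 0 implies
  δ ≤ Σ_{d ≠ c} (A_j + A_{j+1} + A_{j+2})(d).
Minimising Σ A_j(c) under these constraints is a linear program for each sequence of
colour sets, and it is bounded below by a dual solution, found layer by layer: giving
the constraint of colour c in a layer the weight y(c) uses up Σ_{d ≠ c} y(d) of the
capacity of colour c in three consecutive layers.  All that matters of a partial dual
solution is the capacity it leaves in the last two layers and its value.  The list
`states` records, up to renaming colours, which partial solutions can be guaranteed;
it is closed under appending any colour set that can follow, and shows that the number
of vertices is at least 13/32 δ per layer, up to a bounded multiple of δ.
As 32/13 < 57/23, the theorem follows.
-}

open import Defs hiding (sym)
open import Data.Bool using (Bool; true; false; T; if_then_else_)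
open import Data.Bool.Properties using (T?) renaming (_≟_ to _≟ᵇ_)
open import Data.Fin using (Fin; zero; suc; _≟_; punchOut)
open import Data.Fin.Patterns using (0F; 1F; 2F)
open import Data.Fin.Permutation as Perm using (Permutation′; _⟨$⟩ʳ_; _∘ₚ_; transpose)
open import Data.Fin.Properties using (any?; punchInᵢ≢i)
open import Data.List using (List; []; _∷_; map; length; filter)
import Data.List as List
open import Data.List.Membership.Propositional using (find)
open import Data.List.Relation.Unary.All as All using (All; []; _∷_)
import Data.List.Relation.Unary.All.Properties as All
open import Data.List.Relation.Unary.Any as Any using (Any)
import Data.List.Relation.Unary.Any.Properties as Any
open import Data.Nat as ℕ using (ℕ; zero; suc; _+_; _*_; _≤_; _<_; _≤?_; _<?_; _<ᵇ_; z≤n; s≤s)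
open import Data.Nat.Properties hiding (_≟_; _≤?_; _<?_)
open import Data.Nat.Tactic.RingSolver using (solve-∀)
open import Data.Product using (∃; _×_; _,_; proj₁; proj₂)
open import Data.Sum using (_⊎_; inj₁; inj₂)
open import Data.Unit using (⊤; tt)
open import Data.Vec using (Vec; []; _∷_; lookup; tabulate) renaming (sum to sumᵥ)
open import Data.Vec.Functional using (removeAt)
open import Data.Vec.Functional.Properties using (removeAt-punchOut)
open import Data.Vec.Properties using (≡-dec; lookup∘tabulate)
open import Function using (_∘_; id)
open import Relation.Binary.PropositionalEquality hiding ([_])
open import Relation.Nullary using (¬_; Dec; yes; no; does)
open import Relation.Nullary.Decidable using (map′; _×-dec_; _→-dec_; ¬?; toWitness)
open import Relation.Nullary.Negation using (contradiction)
open import Relation.Unary using (Decidable)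
open import Algebra.Properties.Semiring.Sum +-*-semiring
  using (sum; sum-syntax; ∑-distrib-+; ∑-comm; *-distribˡ-sum; sum-permute; sum-cong-≗; sum-remove)

-- Colour sets, partial dual solutions and the certificate

Colour : Set
Colour = Fin 3

ColourSet : Set
ColourSet = Vec Bool 3

Weights : Set
Weights = Vec ℕ 3

infix 4 _∈_

_∈_ : Colour → ColourSet → Set
c ∈ Q = T (lookup Q c)

_∈?_ : ∀ c Q → Dec (c ∈ Q)
c ∈? Q = T? (lookup Q c)

pattern ⟨_,_,_⟩ a b c = a ∷ b ∷ c ∷ []
pattern I = true
pattern O = false

infix 6 _∥_⊹_
infix 4 _▹_
infixr 7 _·_ _·ᵖ_ _·ˢ_

-- A partial dual solution.  Each vertex is worth 32, that is 4 units of capacity of size 8;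
-- α and β are the capacities left in the last two layers.  The value g is measured in units
-- of δ and relative to a gain of 13 per layer, shifted to make it a natural number.
record Piece : Set where
  constructor _∥_⊹_
  field
    α β : Weights
    g   : ℕ
open Piece

-- `present` is the colour set of the last layer; every piece of the state is available.
record State : Set where
  constructor _▹_
  field
    present : ColourSet
    pieces  : List Piece
open State

-- The certificate was found by a computer search.  The entry 8 of α exceeds the full capacity 4:
-- it occurs when the colour is absent from the older layer, where any capacity may be claimed.
-- The entries of β outside `present` are likewise irrelevant.
moves : List Weights
moves =
  ⟨ 0 , 0 , 0 ⟩ ∷ ⟨ 0 , 0 , 1 ⟩ ∷ ⟨ 0 , 0 , 2 ⟩ ∷ ⟨ 0 , 0 , 3 ⟩ ∷ ⟨ 0 , 0 , 4 ⟩ ∷ ⟨ 0 , 1 , 1 ⟩ ∷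
  ⟨ 0 , 2 , 0 ⟩ ∷ ⟨ 0 , 2 , 2 ⟩ ∷ ⟨ 1 , 0 , 0 ⟩ ∷ ⟨ 1 , 0 , 1 ⟩ ∷ ⟨ 1 , 1 , 0 ⟩ ∷ ⟨ 1 , 1 , 1 ⟩ ∷
  ⟨ 1 , 1 , 2 ⟩ ∷ ⟨ 2 , 0 , 0 ⟩ ∷ ⟨ 2 , 0 , 2 ⟩ ∷ ⟨ 2 , 2 , 0 ⟩ ∷ ⟨ 3 , 1 , 1 ⟩ ∷ ⟨ 4 , 0 , 0 ⟩ ∷
  []

states : List State
states =
  (⟨ I , O , O ⟩ ▹ ⟨ 0 , 0 , 0 ⟩ ∥ ⟨ 2 , 0 , 0 ⟩ ⊹ 25 ∷ []) ∷
  (⟨ I , O , O ⟩ ▹ ⟨ 0 , 2 , 2 ⟩ ∥ ⟨ 4 , 0 , 0 ⟩ ⊹ 12 ∷ []) ∷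
  (⟨ I , I , O ⟩ ▹ ⟨ 0 , 0 , 0 ⟩ ∥ ⟨ 2 , 2 , 0 ⟩ ⊹ 25 ∷ []) ∷
  (⟨ I , I , O ⟩ ▹ ⟨ 2 , 2 , 4 ⟩ ∥ ⟨ 2 , 2 , 0 ⟩ ⊹ 8 ∷ ⟨ 4 , 4 , 4 ⟩ ∥ ⟨ 4 , 4 , 0 ⟩ ⊹ 3 ∷ []) ∷
  (⟨ I , O , O ⟩ ▹ ⟨ 2 , 0 , 2 ⟩ ∥ ⟨ 4 , 0 , 0 ⟩ ⊹ 16 ∷ ⟨ 3 , 2 , 3 ⟩ ∥ ⟨ 4 , 0 , 0 ⟩ ⊹ 8 ∷ []) ∷
  (⟨ I , I , O ⟩ ▹ ⟨ 2 , 2 , 2 ⟩ ∥ ⟨ 4 , 4 , 0 ⟩ ⊹ 12 ∷ []) ∷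
  (⟨ I , O , O ⟩ ▹ ⟨ 8 , 3 , 3 ⟩ ∥ ⟨ 2 , 0 , 0 ⟩ ⊹ 11 ∷ []) ∷
  (⟨ I , I , O ⟩ ▹ ⟨ 0 , 2 , 0 ⟩ ∥ ⟨ 4 , 4 , 0 ⟩ ⊹ 16 ∷
                     ⟨ 2 , 3 , 2 ⟩ ∥ ⟨ 4 , 4 , 0 ⟩ ⊹ 8 ∷
                     ⟨ 4 , 4 , 4 ⟩ ∥ ⟨ 4 , 4 , 0 ⟩ ⊹ 0 ∷ []) ∷
  (⟨ I , I , O ⟩ ▹ ⟨ 1 , 1 , 2 ⟩ ∥ ⟨ 1 , 1 , 0 ⟩ ⊹ 22 ∷ []) ∷
  (⟨ I , I , O ⟩ ▹ ⟨ 0 , 2 , 0 ⟩ ∥ ⟨ 4 , 4 , 0 ⟩ ⊹ 21 ∷ ⟨ 2 , 2 , 2 ⟩ ∥ ⟨ 3 , 3 , 0 ⟩ ⊹ 13 ∷ []) ∷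
  (⟨ I , O , O ⟩ ▹ ⟨ 2 , 2 , 0 ⟩ ∥ ⟨ 4 , 0 , 0 ⟩ ⊹ 21 ∷ []) ∷
  (⟨ I , I , O ⟩ ▹ ⟨ 2 , 4 , 4 ⟩ ∥ ⟨ 2 , 2 , 0 ⟩ ⊹ 15 ∷ []) ∷
  (⟨ I , I , I ⟩ ▹ ⟨ 2 , 0 , 2 ⟩ ∥ ⟨ 2 , 0 , 2 ⟩ ⊹ 22 ∷ []) ∷
  (⟨ I , I , I ⟩ ▹ ⟨ 0 , 0 , 0 ⟩ ∥ ⟨ 2 , 3 , 2 ⟩ ⊹ 25 ∷ []) ∷
  (⟨ I , I , I ⟩ ▹ ⟨ 4 , 4 , 4 ⟩ ∥ ⟨ 4 , 4 , 4 ⟩ ⊹ 3 ∷ []) ∷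
  (⟨ I , O , O ⟩ ▹ ⟨ 8 , 4 , 4 ⟩ ∥ ⟨ 4 , 0 , 0 ⟩ ⊹ 8 ∷ []) ∷
  (⟨ I , O , O ⟩ ▹ ⟨ 8 , 2 , 2 ⟩ ∥ ⟨ 0 , 0 , 0 ⟩ ⊹ 22 ∷ []) ∷
  (⟨ I , I , I ⟩ ▹ ⟨ 2 , 2 , 0 ⟩ ∥ ⟨ 4 , 4 , 4 ⟩ ⊹ 21 ∷ ⟨ 2 , 2 , 2 ⟩ ∥ ⟨ 3 , 3 , 4 ⟩ ⊹ 13 ∷ []) ∷
  (⟨ I , I , O ⟩ ▹ ⟨ 0 , 0 , 0 ⟩ ∥ ⟨ 2 , 0 , 0 ⟩ ⊹ 29 ∷
                     ⟨ 0 , 0 , 0 ⟩ ∥ ⟨ 3 , 2 , 0 ⟩ ⊹ 21 ∷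
                     ⟨ 0 , 0 , 0 ⟩ ∥ ⟨ 4 , 4 , 0 ⟩ ⊹ 13 ∷ []) ∷
  (⟨ I , I , I ⟩ ▹ ⟨ 2 , 3 , 2 ⟩ ∥ ⟨ 4 , 4 , 4 ⟩ ⊹ 12 ∷ []) ∷
  (⟨ I , I , O ⟩ ▹ ⟨ 2 , 8 , 2 ⟩ ∥ ⟨ 2 , 0 , 0 ⟩ ⊹ 22 ∷ []) ∷
  (⟨ I , I , O ⟩ ▹ ⟨ 0 , 8 , 0 ⟩ ∥ ⟨ 2 , 0 , 0 ⟩ ⊹ 34 ∷ ⟨ 1 , 8 , 1 ⟩ ∥ ⟨ 3 , 2 , 0 ⟩ ⊹ 18 ∷ []) ∷
  (⟨ I , I , I ⟩ ▹ ⟨ 0 , 2 , 2 ⟩ ∥ ⟨ 4 , 4 , 4 ⟩ ⊹ 16 ∷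
                     ⟨ 2 , 3 , 3 ⟩ ∥ ⟨ 4 , 4 , 4 ⟩ ⊹ 8 ∷
                     ⟨ 4 , 4 , 4 ⟩ ∥ ⟨ 4 , 4 , 4 ⟩ ⊹ 0 ∷ []) ∷
  (⟨ I , I , I ⟩ ▹ ⟨ 0 , 0 , 8 ⟩ ∥ ⟨ 2 , 2 , 0 ⟩ ⊹ 29 ∷
                     ⟨ 0 , 0 , 8 ⟩ ∥ ⟨ 3 , 3 , 2 ⟩ ⊹ 21 ∷
                     ⟨ 0 , 0 , 8 ⟩ ∥ ⟨ 4 , 4 , 4 ⟩ ⊹ 13 ∷ []) ∷
  (⟨ I , I , I ⟩ ▹ ⟨ 0 , 0 , 8 ⟩ ∥ ⟨ 2 , 2 , 0 ⟩ ⊹ 34 ∷ ⟨ 1 , 1 , 8 ⟩ ∥ ⟨ 3 , 3 , 2 ⟩ ⊹ 18 ∷ []) ∷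
  (⟨ I , I , O ⟩ ▹ ⟨ 0 , 0 , 0 ⟩ ∥ ⟨ 0 , 0 , 0 ⟩ ⊹ 26 ∷
                     ⟨ 1 , 1 , 2 ⟩ ∥ ⟨ 1 , 1 , 0 ⟩ ⊹ 18 ∷
                     ⟨ 2 , 2 , 4 ⟩ ∥ ⟨ 2 , 2 , 0 ⟩ ⊹ 10 ∷ []) ∷
  (⟨ I , O , O ⟩ ▹ ⟨ 0 , 0 , 0 ⟩ ∥ ⟨ 0 , 0 , 0 ⟩ ⊹ 29 ∷
                     ⟨ 0 , 0 , 0 ⟩ ∥ ⟨ 2 , 0 , 0 ⟩ ⊹ 21 ∷
                     ⟨ 0 , 0 , 0 ⟩ ∥ ⟨ 4 , 0 , 0 ⟩ ⊹ 13 ∷ []) ∷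
  (⟨ I , I , I ⟩ ▹ ⟨ 0 , 0 , 0 ⟩ ∥ ⟨ 2 , 0 , 2 ⟩ ⊹ 34 ∷ ⟨ 0 , 0 , 0 ⟩ ∥ ⟨ 2 , 2 , 2 ⟩ ⊹ 26 ∷ []) ∷
  (⟨ I , I , I ⟩ ▹ ⟨ 2 , 4 , 8 ⟩ ∥ ⟨ 2 , 4 , 2 ⟩ ⊹ 15 ∷ []) ∷
  (⟨ I , O , O ⟩ ▹ ⟨ 8 , 0 , 0 ⟩ ∥ ⟨ 0 , 0 , 0 ⟩ ⊹ 34 ∷ ⟨ 8 , 1 , 1 ⟩ ∥ ⟨ 2 , 0 , 0 ⟩ ⊹ 18 ∷ []) ∷
  []

-- Renaming colours and the finite check of the certificate

perms : List (Permutation′ 3)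
perms = Perm.id ∷ transpose 0F 1F ∷ transpose 0F 2F ∷ transpose 1F 2F
      ∷ transpose 0F 1F ∘ₚ transpose 1F 2F ∷ transpose 1F 2F ∘ₚ transpose 0F 1F ∷ []

_·_ : {A : Set} → Permutation′ 3 → Vec A 3 → Vec A 3
π · v = tabulate (lookup v ∘ (π ⟨$⟩ʳ_))

_·ᵖ_ : Permutation′ 3 → Piece → Piece
π ·ᵖ (α ∥ β ⊹ g) = π · α ∥ π · β ⊹ g

_·ˢ_ : Permutation′ 3 → State → State
π ·ˢ (Q ▹ ps) = π · Q ▹ map (π ·ᵖ_) ps

allColours? : {P : Colour → Set} → Decidable P → Dec (∀ c → P c)
allColours? P? = map′
  (λ { (a , b , c) 0F → a ; (a , b , c) 1F → b ; (a , b , c) 2F → c })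
  (λ f → f 0F , f 1F , f 2F)
  (P? 0F ×-dec P? 1F ×-dec P? 2F)

allSets? : ∀ {n} {P : Vec Bool n → Set} → Decidable P → Dec (∀ Q → P Q)
allSets? {zero}  P? = map′ (λ { p [] → p }) (λ f → f []) (P? [])
allSets? {suc n} P? = map′
  (λ { (f , g) (I ∷ Q) → f Q ; (f , g) (O ∷ Q) → g Q })
  (λ f → f ∘ (I ∷_) , f ∘ (O ∷_))
  (allSets? (P? ∘ (I ∷_)) ×-dec allSets? (P? ∘ (O ∷_)))

-- Passing from p to p′ by giving weights y to the constraints of the layer with colours Q, when
-- a layer with colours R follows.  Colour c pays sumᵥ y ∸ lookup y c in each of the three layers;
-- lookup y c is moved to the other side to avoid subtraction.
record Charge (Q R : ColourSet) (p′ p : Piece) (y : Weights) : Set where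
  constructor charge
  field
    gain    : g p′ + 13 ≤ g p + 8 * sumᵥ y
    support : ∀ c → ¬ c ∈ Q → lookup y c ≤ 0
    left    : ∀ c → sumᵥ y ≤ lookup (α p) c + lookup y c
    centre  : ∀ c → c ∈ Q → lookup (α p′) c + sumᵥ y ≤ lookup (β p) c + lookup y c
    right   : ∀ c → c ∈ R → lookup (β p′) c + sumᵥ y ≤ 4 + lookup y c

charge? : ∀ Q R p′ p y → Dec (Charge Q R p′ p y)
charge? Q R p′ p y =
  map′ (λ (a , b , c , d , e) → charge a b c d e) (λ (charge a b c d e) → a , b , c , d , e)
    (     (g p′ + 13 ≤? g p + 8 * sumᵥ y)
    ×-dec allColours? (λ c → ¬? (c ∈? Q) →-dec (lookup y c ≤? 0))
    ×-dec allColours? (λ c → sumᵥ y ≤? lookup (α p) c + lookup y c)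
    ×-dec allColours? (λ c → (c ∈? Q) →-dec (lookup (α p′) c + sumᵥ y ≤? lookup (β p) c + lookup y c))
    ×-dec allColours? (λ c → (c ∈? R) →-dec (lookup (β p′) c + sumᵥ y ≤? 4 + lookup y c)))

-- Each piece of the new state has to arise from some piece of the old one by some move, so that all
-- pieces stay available whichever is needed later.
Step : State → ColourSet → State → Set
Step s R t = present t ≡ R
           × All (λ p′ → Any (λ p → Any (Charge (present s) R p′ p) moves) (pieces s)) (pieces t)

step? : ∀ s R t → Dec (Step s R t)
step? s R t = ≡-dec _≟ᵇ_ (present t) R
  ×-dec All.all? (λ p′ → Any.any? (λ p → Any.any? (charge? (present s) R p′ p) moves) (pieces s))
                 (pieces t)

-- A vertex has a neighbour, of another colour, in the layer before its own.
Follows : ColourSet → ColourSet → Set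
Follows Q R = ¬ (∀ c → ¬ c ∈ R) × (∀ c → c ∈ R → ¬ (∀ d → d ∈ Q → d ≡ c))

follows? : ∀ Q R → Dec (Follows Q R)
follows? Q R = ¬? (allColours? λ c → ¬? (c ∈? R))
  ×-dec allColours? λ c → (c ∈? R) →-dec ¬? (allColours? λ d → (d ∈? Q) →-dec (d ≟ c))

-- State and next colour set are renamed together, by all six permutations, since `states` lists
-- each situation only up to renaming.
orbit : State → ColourSet → List (State × ColourSet)
orbit s R = map (λ π → π ·ˢ s , π · R) perms

Continues : List (State × ColourSet) → Set
Continues xs = Any (λ t → Any (λ (s , R) → Step s R t) xs) states

continues? : Decidable Continues
continues? xs = Any.any? (λ t → Any.any? (λ (s , R) → step? s R t) xs) states

-- The first component ensures that a bound can be read off when the layers end.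
Closed : State → Set
Closed s = Any (λ _ → ⊤) (pieces s) × (∀ R → Follows (present s) R → Continues (orbit s R))

closed? : Decidable Closed
closed? s = Any.any? (λ _ → yes tt) (pieces s)
  ×-dec allSets? λ R → follows? (present s) R →-dec continues? (orbit s R)

-- Holds by evaluation of the decision procedure. All of the linear programming is contained in this
-- finite check.
closed : All Closed states
closed = toWitness {a? = All.all? closed? states} tt

-- Describes a start at a layer with a single colour, named `0F`. The bound 41 on the initial gain
-- becomes the additive term 41δ, and 4 is the full capacity of a vertex.
Root : State → Set
Root s = present s ≡ ⟨ I , O , O ⟩ × All (λ p → g p ≤ 41 × lookup (β p) 0F ≤ 4) (pieces s)

root : Any Root states
root = toWitness {a? = Any.any? root? states} tt
  where
  root? : Decidable Root
  root? s = ≡-dec _≟ᵇ_ (present s) _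
    ×-dec All.all? (λ p → (g p ≤? 41) ×-dec (lookup (β p) 0F ≤? 4)) (pieces s)

-- From the certificate to a bound for sequences of layers

Layer : Set
Layer = Colour → ℕ

∑-mono : ∀ {n} {f g : Fin n → ℕ} → (∀ i → f i ≤ g i) → sum f ≤ sum g
∑-mono {zero}  f≤g = z≤n
∑-mono {suc n} f≤g = +-mono-≤ (f≤g zero) (∑-mono (f≤g ∘ suc))

lookup≤∑ : ∀ {n} (f : Fin n → ℕ) i → f i ≤ sum f
lookup≤∑ f zero    = m≤m+n _ _
lookup≤∑ f (suc i) = ≤-trans (lookup≤∑ (f ∘ suc) i) (m≤n+m _ _)

0<∑⇒∃ : ∀ {n} (f : Fin n → ℕ) → 0 < sum f → ∃ λ i → 0 < f i
0<∑⇒∃ {suc n} f 0<∑ with f zero in eq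
... | suc _ = zero , subst (0 <_) (sym eq) (s≤s z≤n)
... | zero  = let i , 0<fi = 0<∑⇒∃ (f ∘ suc) 0<∑ in suc i , 0<fi

weigh : Layer → Layer → ℕ
weigh w A = ∑[ c < 3 ] (w c * A c)

-- Only colours that occur in the layer have to be compared; this is why `Charge` may leave
-- capacities of absent colours unconstrained.
weigh-mono : ∀ {w w′} A → (∀ c → 0 < A c → w c ≤ w′ c) → weigh w A ≤ weigh w′ A
weigh-mono {w} {w′} A w≤w′ = ∑-mono λ c → pointwise c (A c) refl
  where
  pointwise : ∀ c a → A c ≡ a → w c * A c ≤ w′ c * A c
  pointwise c zero    eq rewrite eq | *-zeroʳ (w c) = z≤n
  pointwise c (suc a) eq = *-monoˡ-≤ (A c) (w≤w′ c (subst (0 <_) (sym eq) (s≤s z≤n)))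

weigh-+ : ∀ w w′ A → weigh (λ c → w c + w′ c) A ≡ weigh w A + weigh w′ A
weigh-+ w w′ A = trans
  (sum-cong-≗ λ c → *-distribʳ-+ (A c) (w c) (w′ c))
  (∑-distrib-+ (λ c → w c * A c) (λ c → w′ c * A c))

weigh-const : ∀ k A → weigh (λ _ → k) A ≡ k * sum A
weigh-const k A = sym (*-distribˡ-sum k A)

dot : Weights → Layer → ℕ
dot w = weigh (lookup w)

-- The capacity left in the last two layers is added to the gain; the factor 8 converts its units to
-- the scale on which a vertex is worth 32.
value : ℕ → Piece → Layer → Layer → ℕ
value δ p A B = δ * g p + 8 * (dot (α p) A + dot (β p) B)

window : Layer → Layer → Layer → Layer
window A B C c = A c + B c + C c

-- `neighbours` is the degree condition without subtraction: at least δ vertices of the window have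
-- a colour other than c. `parent` reflects that a vertex of C has a neighbour of another colour in
-- B.
record Window (δ : ℕ) (A B C : Layer) : Set where
  field
    neighbours : ∀ c → 0 < B c → δ + window A B C c ≤ sum (window A B C)
    parent     : ∀ c → 0 < C c → B c < sum B
    nonempty   : 0 < sum C
open Window

record _Supports_ (Q : ColourSet) (A : Layer) : Set where
  field
    occurs  : ∀ c → c ∈ Q → 0 < A c
    covers : ∀ c → 0 < A c → c ∈ Q
open _Supports_

∑-window : ∀ A B C → sum (window A B C) ≡ sum A + sum B + sum C
∑-window A B C = trans (∑-distrib-+ (λ c → A c + B c) C) (cong (_+ sum C) (∑-distrib-+ A B))

dot-window : ∀ y A B C → dot y (window A B C) ≡ dot y A + dot y B + dot y C
dot-window y A B C = trans
  (sum-cong-≗ λ c → distrib (lookup y c) (A c) (B c) (C c))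
  (∑-window (λ c → lookup y c * A c) (λ c → lookup y c * B c) (λ c → lookup y c * C c))
  where
  distrib : ∀ w a b c → w * (a + b + c) ≡ w * a + w * b + w * c
  distrib = solve-∀

-- Weak duality for three consecutive layers

sumᵥ≡ : ∀ (y : Weights) → sum (lookup y) ≡ sumᵥ y
sumᵥ≡ ⟨ a , b , c ⟩ = refl

-- The degree condition of colour c is multiplied by y(c) and summed over the colours. It is
-- available only for colours present in B, so y must vanish on the others.
total-charge : ∀ {δ Q A B C} y → Window δ A B C → Q Supports B →
  (∀ c → ¬ c ∈ Q → lookup y c ≤ 0) →
  δ * sumᵥ y + (dot y A + dot y B + dot y C) ≤ sumᵥ y * (sum A + sum B + sum C)
total-charge {δ} {Q} {A} {B} {C} y win QB supp = begin
  δ * sumᵥ y + (dot y A + dot y B + dot y C)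
    ≡⟨ cong₂ _+_ (trans (cong (δ *_) (sym (sumᵥ≡ y))) (*-distribˡ-sum δ (lookup y)))
                 (sym (dot-window y A B C)) ⟩
  sum (λ c → δ * lookup y c) + dot y W
    ≡⟨ sym (∑-distrib-+ (λ c → δ * lookup y c) (λ c → lookup y c * W c)) ⟩
  ∑[ c < 3 ] (δ * lookup y c + lookup y c * W c)
    ≤⟨ ∑-mono pointwise ⟩
  ∑[ c < 3 ] (sum W * lookup y c)
    ≡⟨ sym (*-distribˡ-sum (sum W) (lookup y)) ⟩
  sum W * sum (lookup y)
    ≡⟨ trans (*-comm (sum W) _) (cong₂ _*_ (sumᵥ≡ y) (∑-window A B C)) ⟩
  sumᵥ y * (sum A + sum B + sum C) ∎
  where
  open ≤-Reasoning
  W = window A B C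
  pointwise : ∀ c → δ * lookup y c + lookup y c * W c ≤ sum W * lookup y c
  pointwise c with c ∈? Q
  ... | yes c∈Q = begin
    δ * lookup y c + lookup y c * W c ≡⟨ cong (δ * lookup y c +_) (*-comm (lookup y c) (W c)) ⟩
    δ * lookup y c + W c * lookup y c ≡⟨ *-distribʳ-+ (lookup y c) δ (W c) ⟨
    (δ + W c) * lookup y c            ≤⟨ *-monoˡ-≤ (lookup y c) (neighbours win c (occurs QB c c∈Q)) ⟩
    sum W * lookup y c                ∎
  ... | no c∉Q rewrite n≤0⇒n≡0 (supp c c∉Q) | *-zeroʳ δ = z≤n

transfer : ∀ {σ : ℕ} {w w′ y : Weights} (A : Layer) →
  (∀ c → 0 < A c → lookup w c + σ ≤ lookup w′ c + lookup y c) →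
  dot w A + σ * sum A ≤ dot w′ A + dot y A
transfer {σ} {w} {w′} {y} A h = begin
  dot w A + σ * sum A                 ≡⟨ cong (dot w A +_) (sym (weigh-const σ A)) ⟩
  dot w A + weigh (λ _ → σ) A         ≡⟨ sym (weigh-+ (lookup w) (λ _ → σ) A) ⟩
  weigh (λ c → lookup w c + σ) A      ≤⟨ weigh-mono A h ⟩
  weigh (λ c → lookup w′ c + lookup y c) A ≡⟨ weigh-+ (lookup w′) (lookup y) A ⟩
  dot w′ A + dot y A ∎
  where open ≤-Reasoning

-- The capacity spent on the three layers pays for the degree conditions of B, while each vertex of
-- C brings new capacity 4, worth 8 · 4 = 32. The base b absorbs the 13δ that each layer is expected
-- to gain.
transition : ∀ {δ Q R p′ p y A B C b X N N′} →
  Charge Q R p′ p y → Window δ A B C → Q Supports B → R Supports C →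
  b + value δ p A B ≤ X + 32 * N → N + sum C ≤ N′ → (b + δ * 13) + value δ p′ B C ≤ X + 32 * N′
transition {δ} {Q} {R} {p′} {p} {y} {A} {B} {C} {b} {X} {N} {N′} ch win QB RC bound grows = begin
  b + δ * 13 + (δ * g p′ + 8 * (α′B + β′C))  ≡⟨ reorder₁ b δ (g p′) (α′B + β′C) ⟩
  b + δ * (g p′ + 13) + 8 * (α′B + β′C)      ≤⟨ +-monoˡ-≤ _ (+-monoʳ-≤ b (*-monoʳ-≤ δ gain)) ⟩
  b + δ * (g p + 8 * σ) + 8 * (α′B + β′C)    ≡⟨ reorder₂ b δ (g p) σ α′B β′C ⟩
  b + δ * g p + 8 * (δ * σ + α′B + β′C)      ≤⟨ +-monoʳ-≤ (b + δ * g p) (*-monoʳ-≤ 8 exchange) ⟩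
  b + δ * g p + 8 * (αA + βB + 4 * sum C)    ≡⟨ reorder₃ b (δ * g p) (αA + βB) (sum C) ⟩
  b + (δ * g p + 8 * (αA + βB)) + 32 * sum C ≤⟨ +-monoˡ-≤ (32 * sum C) bound ⟩
  X + 32 * N + 32 * sum C                    ≡⟨ reorder₄ X N (sum C) ⟩
  X + 32 * (N + sum C)                       ≤⟨ +-monoʳ-≤ X (*-monoʳ-≤ 32 grows) ⟩
  X + 32 * N′                                ∎
  where
  open ≤-Reasoning
  open Charge ch
  σ = sumᵥ y
  α′B = dot (α p′) B
  β′C = dot (β p′) C
  αA = dot (α p) A
  βB = dot (β p) B
  yA = dot y A
  yB = dot y B
  yC = dot y C
  -- A is no longer among the last two layers, so none of its capacity is kept: the new weight is
  -- zero.
  onA : σ * sum A ≤ αA + yA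
  onA = transfer {σ} {⟨ 0 , 0 , 0 ⟩} {α p} {y} A λ { 0F _ → left 0F ; 1F _ → left 1F ; 2F _ → left 2F }
  onB : α′B + σ * sum B ≤ βB + yB
  onB = transfer {σ} {α p′} {β p} {y} B λ c 0<B → centre c (covers QB c 0<B)
  onC : β′C + σ * sum C ≤ 4 * sum C + yC
  onC = subst (λ z → β′C + σ * sum C ≤ z + yC) (weigh-const 4 C)
    (transfer {σ} {β p′} {⟨ 4 , 4 , 4 ⟩} {y} C λ
      { 0F 0<C → right 0F (covers RC 0F 0<C)
      ; 1F 0<C → right 1F (covers RC 1F 0<C)
      ; 2F 0<C → right 2F (covers RC 2F 0<C) })
  reorder₁ : ∀ b δ g v → b + δ * 13 + (δ * g + 8 * v) ≡ b + δ * (g + 13) + 8 * v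
  reorder₁ = solve-∀
  reorder₂ : ∀ b δ g σ v w → b + δ * (g + 8 * σ) + 8 * (v + w) ≡ b + δ * g + 8 * (δ * σ + v + w)
  reorder₂ = solve-∀
  reorder₃ : ∀ b v w c → b + v + 8 * (w + 4 * c) ≡ b + (v + 8 * w) + 32 * c
  reorder₃ = solve-∀
  reorder₄ : ∀ x n c → x + 32 * n + 32 * c ≡ x + 32 * (n + c)
  reorder₄ = solve-∀
  reorder₅ : ∀ u v w y → u + v + w + y ≡ u + y + v + w
  reorder₅ = solve-∀
  reorder₆ : ∀ σ a b c v w → σ * (a + b + c) + v + w ≡ σ * a + (v + σ * b) + (w + σ * c)
  reorder₆ = solve-∀
  reorder₇ : ∀ a b c x y z → a + x + (b + y) + (c + z) ≡ a + b + c + (x + y + z)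
  reorder₇ = solve-∀
  -- The y-terms of all three layers are added on both sides in place of the subtraction in the
  -- charge σ - y(c), and cancelled at the end.
  exchange : δ * σ + α′B + β′C ≤ αA + βB + 4 * sum C
  exchange = +-cancelʳ-≤ (yA + yB + yC) _ _ (begin
    δ * σ + α′B + β′C + (yA + yB + yC)                     ≡⟨ reorder₅ (δ * σ) α′B β′C (yA + yB + yC) ⟩
    δ * σ + (yA + yB + yC) + α′B + β′C                     ≤⟨ +-monoˡ-≤ β′C (+-monoˡ-≤ α′B
                                                                (total-charge {Q = Q} y win QB support)) ⟩
    σ * (sum A + sum B + sum C) + α′B + β′C                ≡⟨ reorder₆ σ (sum A) (sum B) (sum C) α′B β′C ⟩
    σ * sum A + (α′B + σ * sum B) + (β′C + σ * sum C)      ≤⟨ +-mono-≤ (+-mono-≤ onA onB) onC ⟩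
    αA + yA + (βB + yB) + (4 * sum C + yC)                 ≡⟨ reorder₇ αA βB (4 * sum C) yA yB yC ⟩
    αA + βB + 4 * sum C + (yA + yB + yC)                   ∎)

-- Invariance under renaming colours

∑-permute : ∀ (π : Permutation′ 3) f → sum (f ∘ (π ⟨$⟩ʳ_)) ≡ sum f
∑-permute π f = sym (sum-permute f π)

dot-permute : ∀ π w A → dot (π · w) (A ∘ (π ⟨$⟩ʳ_)) ≡ dot w A
dot-permute π w A = trans
  (sum-cong-≗ λ c → cong (_* A (π ⟨$⟩ʳ c)) (lookup∘tabulate (lookup w ∘ (π ⟨$⟩ʳ_)) c))
  (∑-permute π (λ c → lookup w c * A c))

value-permute : ∀ δ π p A B →
  value δ (π ·ᵖ p) (A ∘ (π ⟨$⟩ʳ_)) (B ∘ (π ⟨$⟩ʳ_)) ≡ value δ p A B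
value-permute δ π p A B =
  cong₂ (λ x y → δ * g p + 8 * (x + y)) (dot-permute π (α p) A) (dot-permute π (β p) B)

Window-permute : ∀ {δ A B C} π → Window δ A B C →
  Window δ (A ∘ (π ⟨$⟩ʳ_)) (B ∘ (π ⟨$⟩ʳ_)) (C ∘ (π ⟨$⟩ʳ_))
Window-permute {δ} {A} {B} {C} π win = record
  { neighbours = λ c 0<B →
      ≤-trans (neighbours win (π ⟨$⟩ʳ c) 0<B) (≤-reflexive (sym (∑-permute π (window A B C))))
  ; parent     = λ c 0<C → ≤-trans (parent win (π ⟨$⟩ʳ c) 0<C) (≤-reflexive (sym (∑-permute π B)))
  ; nonempty   = ≤-trans (nonempty win) (≤-reflexive (sym (∑-permute π C)))
  }

Supports-permute : ∀ {Q A} π → Q Supports A → (π · Q) Supports (A ∘ (π ⟨$⟩ʳ_))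
Supports-permute {Q} π QA = record
  { occurs = λ c c∈πQ → occurs QA (π ⟨$⟩ʳ c) (subst T (lookup∘tabulate (lookup Q ∘ (π ⟨$⟩ʳ_)) c) c∈πQ)
  ; covers = λ c 0<A  → subst T (sym (lookup∘tabulate (lookup Q ∘ (π ⟨$⟩ʳ_)) c)) (covers QA (π ⟨$⟩ʳ c) 0<A)
  }

-- Colour sets of consecutive layers

colours : Layer → ColourSet
colours A = tabulate (λ c → 0 <ᵇ A c)

colours-Supports : ∀ A → colours A Supports A
colours-Supports A = record
  { occurs = λ c c∈ → <ᵇ⇒< 0 (A c) (subst T (lookup∘tabulate (λ c → 0 <ᵇ A c) c) c∈)
  ; covers = λ c 0<A → subst T (sym (lookup∘tabulate (λ c → 0 <ᵇ A c) c)) (<⇒<ᵇ 0<A)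
  }

∑-single : ∀ {n} (f : Fin (suc n) → ℕ) c → (∀ d → 0 < f d → d ≡ c) → sum f ≤ f c
∑-single f c only-c = begin
  sum f                      ≡⟨ sum-remove {i = c} f ⟩
  f c + sum (removeAt f c)   ≤⟨ +-monoʳ-≤ (f c) (≮⇒≥ λ 0<∑ →
                                  let i , 0<fi = 0<∑⇒∃ (removeAt f c) 0<∑
                                  in punchInᵢ≢i c i (only-c _ 0<fi)) ⟩
  f c + 0                    ≡⟨ +-identityʳ (f c) ⟩
  f c                        ∎
  where open ≤-Reasoning

<∑ : ∀ {n} (f : Fin (suc n) → ℕ) {c d} → c ≢ d → 0 < f d → f c < sum f
<∑ f {c} {d} c≢d 0<fd = begin-strict
  f c                      <⟨ m<m+n (f c) 0<fd ⟩
  f c + f d                ≡⟨ cong (f c +_) (removeAt-punchOut f c≢d) ⟨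
  f c + removeAt f c (punchOut c≢d) ≤⟨ +-monoʳ-≤ (f c) (lookup≤∑ (removeAt f c) (punchOut c≢d)) ⟩
  f c + sum (removeAt f c) ≡⟨ sum-remove {i = c} f ⟨
  sum f                    ∎
  where open ≤-Reasoning

-- If c occurred in C and B had no colour but c, then B c would be the whole of `sum B`, against
-- `parent`.
Window⇒Follows : ∀ {δ A B C Q R} → Window δ A B C → Q Supports B → R Supports C → Follows Q R
Window⇒Follows {B = B} {C} win QB RC =
  (λ R-empty → let c , 0<C = 0<∑⇒∃ C (nonempty win) in R-empty c (covers RC c 0<C)) ,
  (λ c c∈R only-c → <⇒≱ (parent win c (occurs RC c c∈R)) (∑-single B c λ d 0<B → only-c d (covers QB d 0<B)))

-- N j plays the role of the number of vertices in the layers up to 1 + j.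
growth : ∀ {δ} k {s} (A : ℕ → Layer) (N : ℕ → ℕ) {b X} → Closed s → present s Supports A 1 →
  All (λ p → b + value δ p (A 0) (A 1) ≤ X + 32 * N 0) (pieces s) →
  (∀ j → j < k → Window δ (A j) (A (1 + j)) (A (2 + j))) →
  (∀ j → N j + sum (A (2 + j)) ≤ N (1 + j)) →
  b + δ * 13 * k ≤ X + 32 * N k
growth {δ} zero A N {b} {X} (nonempty-s , _) QA bounds _ _ =
  -- No layers remain: any one piece suffices, and its nonnegative value is dropped.
  let bound , _ = All.lookupAny bounds nonempty-s in begin
    b + δ * 13 * 0 ≡⟨ cong (b +_) (*-zeroʳ (δ * 13)) ⟩
    b + 0          ≤⟨ +-monoʳ-≤ b z≤n ⟩
    b + value δ (Any.lookup nonempty-s) (A 0) (A 1) ≤⟨ bound ⟩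
    X + 32 * N 0 ∎
  where open ≤-Reasoning
growth {δ} (suc k) {s} A N {b} {X} (_ , continue) QA bounds windows grows
  with find (continue (colours (A 2))
              (Window⇒Follows (windows 0 (s≤s z≤n)) QA (colours-Supports (A 2))))
... | t , t∈states , found
  with Any.satisfied (Any.map⁻ {f = λ π → π ·ˢ s , π · colours (A 2)} {xs = perms} found)
... | π , present-t , steps = begin
    b + δ * 13 * suc k          ≡⟨ cong (b +_) (*-suc (δ * 13) k) ⟩
    b + (δ * 13 + δ * 13 * k)   ≡⟨ +-assoc b _ _ ⟨
    b + δ * 13 + δ * 13 * k     ≤⟨ growth k A′ (N ∘ suc) {X = X} (All.lookup closed t∈states)
                                            tA′ bounds′ windows′ grows′ ⟩
    X + 32 * N (suc k)          ∎
  where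
  open ≤-Reasoning
  -- The induction continues with the sequence shifted by one layer and renamed by π, under which t
  -- continues s. Layer totals do not change, so N is merely shifted.
  A′ : ℕ → Layer
  A′ j = A (suc j) ∘ (π ⟨$⟩ʳ_)
  πA₂ : (π · colours (A 2)) Supports A′ 1
  πA₂ = Supports-permute π (colours-Supports (A 2))
  tA′ : present t Supports A′ 1
  tA′ = subst (_Supports A′ 1) (sym present-t) πA₂
  windows′ : ∀ j → j < k → Window δ (A′ j) (A′ (1 + j)) (A′ (2 + j))
  windows′ j j<k = Window-permute π (windows (suc j) (s≤s j<k))
  grows′ : ∀ j → N (1 + j) + sum (A′ (2 + j)) ≤ N (2 + j)
  grows′ j = subst (λ z → N (suc j) + z ≤ N (2 + j)) (sym (∑-permute π (A (3 + j)))) (grows (suc j))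
  permuted : All (λ p → b + value δ p (A 0 ∘ (π ⟨$⟩ʳ_)) (A 1 ∘ (π ⟨$⟩ʳ_)) ≤ X + 32 * N 0)
                 (map (π ·ᵖ_) (pieces s))
  permuted = All.map⁺ (All.map
    (λ {p} → subst (λ z → b + z ≤ X + 32 * N 0) (sym (value-permute δ π p (A 0) (A 1)))) bounds)
  bounds′ : All (λ p′ → b + δ * 13 + value δ p′ (A′ 0) (A′ 1) ≤ X + 32 * N 1) (pieces t)
  bounds′ = All.map (λ charged →
      let bound , charges = All.lookupAny permuted charged
          _ , ch          = Any.satisfied charges
      in transition {b = b} {X} {N 0} {N 1} ch
           (Window-permute π (windows 0 (s≤s z≤n))) (Supports-permute π QA) πA₂ bound
           (subst (λ z → N 0 + z ≤ N 1) (sym (∑-permute π (A 2))) (grows 0)))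
    steps

-- Distance layers of a graph

infix 9 [_]

[_] : {P : Set} → Dec P → ℕ
[ P? ] = if does P? then 1 else 0

[yes] : {P : Set} (P? : Dec P) → P → [ P? ] ≡ 1
[yes] (yes _) _ = refl
[yes] (no ¬p) p = contradiction p ¬p

[no] : {P : Set} (P? : Dec P) → ¬ P → [ P? ] ≡ 0
[no] (yes p) ¬p = contradiction p ¬p
[no] (no _)  _  = refl

[]≤1 : {P : Set} (P? : Dec P) → [ P? ] ≤ 1
[]≤1 (yes _) = ≤-refl
[]≤1 (no _)  = z≤n

0<[]⇒ : {P : Set} (P? : Dec P) → 0 < [ P? ] → P
0<[]⇒ (yes p) _ = p

∑-×-colour : {P : Set} (P? : Dec P) (a : Colour) → ∑[ c < 3 ] [ P? ×-dec a ≟ c ] ≡ [ P? ]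
∑-×-colour (yes _) 0F = refl
∑-×-colour (yes _) 1F = refl
∑-×-colour (yes _) 2F = refl
∑-×-colour (no _)  _  = refl

[×]≤[] : {P Q : Set} (P? : Dec P) (Q? : Dec Q) → [ P? ×-dec Q? ] ≤ [ P? ]
[×]≤[] (yes _) Q? = []≤1 Q?
[×]≤[] (no _)  _  = z≤n

∑-const-1 : ∀ n → ∑[ x < n ] 1 ≡ n
∑-const-1 zero    = refl
∑-const-1 (suc n) = cong suc (∑-const-1 n)

length-filter-tabulate : ∀ {A : Set} {P : A → Set} (P? : Decidable P) {n} (f : Fin n → A) →
  length (filter P? (List.tabulate f)) ≡ ∑[ x < n ] [ P? (f x) ]
length-filter-tabulate P? {zero}  f = refl
length-filter-tabulate P? {suc n} f with P? (f zero)
... | yes _ = cong suc (length-filter-tabulate P? (f ∘ suc))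
... | no  _ = length-filter-tabulate P? (f ∘ suc)

-- Linear search upwards from 0; the known witness k bounds the recursion.
least : {P : ℕ → Set} → Decidable P → ∀ k → P k → ∃ λ m → P m × (∀ j → P j → m ≤ j)
least P? zero p = zero , p , λ _ _ → z≤n
least P? (suc k) p with P? 0
... | yes p₀ = zero , p₀ , λ _ _ → z≤n
... | no ¬p₀ with least (P? ∘ suc) k p
... | m , pm , minimal = suc m , pm , λ { zero p₀ → contradiction p₀ ¬p₀ ; (suc j) pj → s≤s (minimal j pj) }

module _ {n} (G : Graph n) (v : Fin n) where

  walk? : ∀ k w → Dec (Walk G w v k)
  walk? zero w = map′ (λ { refl → here }) (λ { here → refl }) (w ≟ v)
  walk? (suc k) w = map′ (λ (x , e , walk) → step e walk) (λ { (step e walk) → _ , e , walk })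
    (any? λ x → (adj G w x ≟ᵇ true) ×-dec walk? k x)

module Layers {n} (G : Graph n) (connected : Connected G) (col : Fin n → Colour)
  (proper : ∀ x y → adj G x y ≡ true → col x ≢ col y) (v : Fin n) where

  shortest : ∀ w → ∃ λ k → Walk G w v k × (∀ j → Walk G w v j → k ≤ j)
  shortest w = let k , walk = connected w v in least (λ k → walk? G v k w) k walk

  dist : Fin n → ℕ
  dist w = proj₁ (shortest w)

  geodesic : ∀ w → Walk G w v (dist w)
  geodesic w = proj₁ (proj₂ (shortest w))

  dist-minimal : ∀ w {j} → Walk G w v j → dist w ≤ j
  dist-minimal w = proj₂ (proj₂ (shortest w)) _

  dist-edge : ∀ {w x} → adj G w x ≡ true → dist w ≤ suc (dist x)
  dist-edge e = dist-minimal _ (step e (geodesic _))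

  dist-v : dist v ≡ 0
  dist-v = n≤0⇒n≡0 (dist-minimal v here)

  dist≡0⇒≡v : ∀ {w} → dist w ≡ 0 → w ≡ v
  dist≡0⇒≡v {w} eq with dist w | geodesic w
  dist≡0⇒≡v refl | .0 | here = refl

  parent-of : ∀ {w k} → dist w ≡ suc k → ∃ λ x → adj G w x ≡ true × dist x ≡ k
  parent-of {w} {k} eq with subst (Walk G w v) eq (geodesic w)
  ... | step {w = x} e walk = x , e ,
    ≤-antisym (dist-minimal x walk) (≤-pred (subst (_≤ suc (dist x)) eq (dist-edge e)))

  -- Following parents from u for i steps reaches distance j, so no layer between v and u is empty.
  at-distance : ∀ {u} i j → dist u ≡ i + j → ∃ λ x → dist x ≡ j
  at-distance zero    j eq = _ , eq
  at-distance (suc i) j eq = let x , _ , eq′ = parent-of eq in at-distance i j eq′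

  -- The shift by one makes layer 0 empty and layer 1 the layer of v, so that v too is in the middle
  -- of a window.
  height : Fin n → ℕ
  height x = suc (dist x)

  member : ℕ → Colour → Fin n → ℕ
  member j c x = [ height x ℕ.≟ j ×-dec col x ≟ c ]

  layer : ℕ → Layer
  layer j c = ∑[ x < n ] member j c x

  below : ℕ → ℕ
  below j = ∑[ x < n ] [ height x <? j ]

  ∑-member : ∀ j x → ∑[ c < 3 ] member j c x ≡ [ height x ℕ.≟ j ]
  ∑-member j x = ∑-×-colour (height x ℕ.≟ j) (col x)

  layer-occupied : ∀ x → 0 < layer (height x) (col x)
  layer-occupied x = ≤-trans
    (≤-reflexive (sym ([yes] (height x ℕ.≟ height x ×-dec col x ≟ col x) (refl , refl))))
    (lookup≤∑ (member (height x) (col x)) x)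

  layer-occupant : ∀ j c → 0 < layer j c → ∃ λ x → height x ≡ j × col x ≡ c
  layer-occupant j c 0<layer =
    let x , 0<x = 0<∑⇒∃ (member j c) 0<layer in x , 0<[]⇒ (height x ℕ.≟ j ×-dec col x ≟ c) 0<x

  below-grows : ∀ j → below j + sum (layer j) ≤ below (suc j)
  below-grows j = begin
    below j + sum (layer j)
      ≡⟨ cong (below j +_) (∑-comm (member j)) ⟩
    below j + ∑[ x < n ] ∑[ c < 3 ] member j c x
      ≡⟨ ∑-distrib-+ (λ x → [ height x <? j ]) (λ x → ∑[ c < 3 ] member j c x) ⟨
    ∑[ x < n ] ([ height x <? j ] + ∑[ c < 3 ] member j c x)
      ≤⟨ ∑-mono (λ x → ≤-trans
           (≤-reflexive (cong ([ height x <? j ] +_) (∑-member j x)))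
           (split (height x <? j) (height x ℕ.≟ j) (height x <? suc j))) ⟩
    below (suc j) ∎
    where
    open ≤-Reasoning
    split : ∀ {h} (a : Dec (h < j)) (b : Dec (h ≡ j)) (c : Dec (h < suc j)) → [ a ] + [ b ] ≤ [ c ]
    split (yes h<j) (yes refl) _        = contradiction h<j (<-irrefl refl)
    split (yes h<j) (no _)     (yes _)  = ≤-refl
    split (yes h<j) (no _)     (no h≮)  = contradiction (m<n⇒m<1+n h<j) h≮
    split (no _)    (yes refl) (yes _)  = ≤-refl
    split (no _)    (yes refl) (no h≮)  = contradiction ≤-refl h≮
    split (no _)    (no _)     _        = z≤n

  below≤n : ∀ j → below j ≤ n
  below≤n j = ≤-trans (∑-mono λ x → []≤1 (height x <? j)) (≤-reflexive (∑-const-1 n))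

  -- Edges and neighbourhoods in consecutive layers

  height-edge : ∀ {w x j} → adj G w x ≡ true → height w ≡ suc j →
    height x ≡ j ⊎ height x ≡ 1 + j ⊎ height x ≡ 2 + j
  height-edge {w} {x} e refl
    with m≤n⇒m<n∨m≡n (dist-edge e) | m≤n⇒m<n∨m≡n (dist-edge (trans (Graph.sym G x w) e))
  ... | inj₂ eq | _ = inj₁ (sym eq)
  ... | _ | inj₂ eq = inj₂ (inj₂ (cong suc eq))
  ... | inj₁ w≤x | inj₁ x≤w = inj₂ (inj₁ (cong suc (≤-antisym (≤-pred x≤w) (≤-pred w≤x))))

  degree≡ : ∀ w → degree G w ≡ ∑[ x < n ] [ adj G w x ≟ᵇ true ]
  degree≡ w = length-filter-tabulate (λ x → adj G w x ≟ᵇ true) id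

  near : ℕ → Colour → Fin n → ℕ
  near j c x = member j c x + member (1 + j) c x + member (2 + j) c x

  around : ℕ → Layer
  around j = window (layer j) (layer (1 + j)) (layer (2 + j))

  ∑-near : ∀ j c → ∑[ x < n ] near j c x ≡ around j c
  ∑-near j c = trans (∑-distrib-+ (λ x → member j c x + member (1 + j) c x) (member (2 + j) c))
    (cong (_+ layer (2 + j) c) (∑-distrib-+ (member j c) (member (1 + j) c)))

  -- Counted vertex by vertex: a neighbour of w lies in one of the three layers and differs from w
  -- in colour, so it adds one to the right side and only its degree contribution to the left. Any
  -- other vertex adds to the left at most what it adds to the total.
  neighbourhood : ∀ {w j} → height w ≡ suc j →
    degree G w + around j (col w) ≤ sum (around j)
  neighbourhood {w} {j} hw = begin
    degree G w + around j (col w)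
      ≡⟨ cong₂ _+_ (degree≡ w) (sym (∑-near j (col w))) ⟩
    ∑[ x < n ] [ adj G w x ≟ᵇ true ] + ∑[ x < n ] near j (col w) x
      ≡⟨ ∑-distrib-+ (λ x → [ adj G w x ≟ᵇ true ]) (near j (col w)) ⟨
    ∑[ x < n ] ([ adj G w x ≟ᵇ true ] + near j (col w) x)
      ≤⟨ ∑-mono pointwise ⟩
    ∑[ x < n ] ∑[ c < 3 ] near j c x
      ≡⟨ ∑-comm (near j) ⟨
    ∑[ c < 3 ] ∑[ x < n ] near j c x
      ≡⟨ sum-cong-≗ (∑-near j) ⟩
    sum (around j) ∎
    where
    open ≤-Reasoning
    ∑-colour : ∀ x →
      ∑[ c < 3 ] near j c x ≡ [ height x ℕ.≟ j ] + [ height x ℕ.≟ 1 + j ] + [ height x ℕ.≟ 2 + j ]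
    ∑-colour x = trans (∑-window (λ c → member j c x) (λ c → member (1 + j) c x) (λ c → member (2 + j) c x))
      (cong₂ _+_ (cong₂ _+_ (∑-member j x) (∑-member (1 + j) x)) (∑-member (2 + j) x))
    some-layer : ∀ x → adj G w x ≡ true →
      1 ≤ [ height x ℕ.≟ j ] + [ height x ℕ.≟ 1 + j ] + [ height x ℕ.≟ 2 + j ]
    some-layer x e with height-edge e hw
    ... | inj₁ h        = ≤-trans (≤-reflexive (sym ([yes] (height x ℕ.≟ j) h))) (≤-trans (m≤m+n _ _) (m≤m+n _ _))
    ... | inj₂ (inj₁ h) = ≤-trans (≤-reflexive (sym ([yes] (height x ℕ.≟ 1 + j) h)))
                                  (≤-trans (m≤n+m _ [ height x ℕ.≟ j ]) (m≤m+n _ _))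
    ... | inj₂ (inj₂ h) = ≤-trans (≤-reflexive (sym ([yes] (height x ℕ.≟ 2 + j) h))) (m≤n+m _ _)
    pointwise : ∀ x → [ adj G w x ≟ᵇ true ] + near j (col w) x ≤ ∑[ c < 3 ] near j c x
    pointwise x = count (adj G w x ≟ᵇ true)
      where
      absent : adj G w x ≡ true → ∀ i → member i (col w) x ≡ 0
      absent e i = [no] (height x ℕ.≟ i ×-dec col x ≟ col w) λ (_ , eq) → proper w x e (sym eq)
      count : (a : Dec (adj G w x ≡ true)) → [ a ] + near j (col w) x ≤ ∑[ c < 3 ] near j c x
      count (no _)  = lookup≤∑ (λ c → near j c x) (col w)
      count (yes e) rewrite absent e j | absent e (1 + j) | absent e (2 + j) =
        ≤-trans (some-layer x e) (≤-reflexive (sym (∑-colour x)))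

  layer-Window : ∀ {δ} → MinDegreeAtLeast G δ → ∀ u j → j < dist u →
    Window δ (layer j) (layer (1 + j)) (layer (2 + j))
  layer-Window {δ} δ≤deg u j j<D = record
    { neighbours = λ c 0<B → let w , hw , cw = layer-occupant (1 + j) c 0<B in
        subst (λ c → δ + around j c ≤ _) cw
          (≤-trans (+-monoˡ-≤ _ (δ≤deg w)) (neighbourhood hw))
    ; parent = λ c 0<C → let w , hw , cw = layer-occupant (2 + j) c 0<C
                             x , e , dx  = parent-of (suc-injective hw) in
        <∑ (layer (1 + j)) (λ eq → proper w x e (trans cw eq))
          (subst (λ h → 0 < layer h (col x)) (cong suc dx) (layer-occupied x))
    ; nonempty = let i , eq = m≤n⇒∃[o]m+o≡n j<D
                     x , dx = at-distance i (suc j) (trans (sym eq) (+-comm (suc j) i)) in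
        ≤-trans (subst (λ h → 0 < layer h (col x)) (cong suc dx) (layer-occupied x))
          (lookup≤∑ (layer (2 + j)) (col x))
    }

  -- The first layer and the distance bound

  toFront : Permutation′ 3
  toFront = transpose 0F (col v)

  -- Height 1 means distance 0, so layer 1 is v alone; `toFront` swaps its colour with `0F`, the
  -- colour of a `Root` state.
  front : ⟨ I , O , O ⟩ Supports (layer 1 ∘ (toFront ⟨$⟩ʳ_))
  front = record
    { occurs = λ
        { 0F _ → subst (λ c → 0 < layer 1 c) (sym (first (col v)))
                   (subst (λ d → 0 < layer (suc d) (col v)) dist-v (layer-occupied v))
        ; 1F () ; 2F () }
    ; covers = λ c 0<A → let x , hx , cx = layer-occupant 1 _ 0<A in
        only (col v) c (trans (cong col (sym (dist≡0⇒≡v (suc-injective hx)))) cx)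
    }
    where
    first : ∀ a → transpose 0F a ⟨$⟩ʳ 0F ≡ a
    first 0F = refl
    first 1F = refl
    first 2F = refl
    only : ∀ a c → a ≡ transpose 0F a ⟨$⟩ʳ c → c ∈ ⟨ I , O , O ⟩
    only a 0F _ = _
    only 0F 1F ()
    only 0F 2F ()
    only 1F 1F ()
    only 1F 2F ()
    only 2F 1F ()
    only 2F 2F ()

  layer-0-empty : ∀ c → ¬ 0 < layer 0 c
  layer-0-empty c 0<layer with layer-occupant 0 c 0<layer
  ... | _ , () , _

  distance-bound : ∀ {δ} → MinDegreeAtLeast G δ → ∀ u → δ * 13 * dist u ≤ δ * 41 + 32 * n
  distance-bound {δ} δ≤deg u with find root
  ... | s , s∈states , present-s , small = begin
    δ * 13 * dist u
      -- The induction starts with b = 0 and offset X = 41δ; `below (2 + j)` counts the layers 0 to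
      -- 1 + j.
      ≤⟨ growth (dist u) A (λ j → below (2 + j)) {0} {δ * 41} (All.lookup closed s∈states)
           (subst (_Supports A 1) (sym present-s) front)
           (All.map (λ {p} (g≤ , β≤) → initial p g≤ β≤) small)
           (λ j j<D → Window-permute toFront (layer-Window δ≤deg u j j<D))
           (λ j → subst (λ z → below (2 + j) + z ≤ below (3 + j))
                    (sym (∑-permute toFront (layer (2 + j)))) (below-grows (2 + j))) ⟩
    δ * 41 + 32 * below (2 + dist u)
      ≤⟨ +-monoʳ-≤ (δ * 41) (*-monoʳ-≤ 32 (below≤n (2 + dist u))) ⟩
    δ * 41 + 32 * n                  ∎
    where
    open ≤-Reasoning
    A : ℕ → Layer
    A j = layer j ∘ (toFront ⟨$⟩ʳ_)
    -- Layer 0 is empty, so α contributes nothing, and β gives v at most its full worth 8 · 4 = 32.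
    initial : ∀ p → g p ≤ 41 → lookup (β p) 0F ≤ 4 → value δ p (A 0) (A 1) ≤ δ * 41 + 32 * below 2
    initial p g≤ β≤ = +-mono-≤ (*-monoʳ-≤ δ g≤) (begin
      8 * (dot (α p) (A 0) + dot (β p) (A 1)) ≤⟨ *-monoʳ-≤ 8 (+-mono-≤ αA≤0 βA≤) ⟩
      8 * (4 * sum (A 1))                     ≡⟨ *-assoc 8 4 (sum (A 1)) ⟨
      32 * sum (A 1)                          ≡⟨ cong (32 *_) (∑-permute toFront (layer 1)) ⟩
      32 * sum (layer 1)                      ≤⟨ *-monoʳ-≤ 32 (≤-trans (m≤n+m _ (below 1)) (below-grows 1)) ⟩
      32 * below 2 ∎)
      where
      αA≤0 : dot (α p) (A 0) ≤ 0
      αA≤0 = ≤-trans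
        (weigh-mono {lookup (α p)} {λ _ → 0} (A 0) λ c 0<A →
           contradiction 0<A (layer-0-empty (toFront ⟨$⟩ʳ c)))
        (≤-reflexive (weigh-const 0 (A 0)))
      βA≤ : dot (β p) (A 1) ≤ 4 * sum (A 1)
      βA≤ = ≤-trans
        (weigh-mono {lookup (β p)} {λ _ → 4} (A 1) λ c 0<A → at-front c (covers front c 0<A))
        (≤-reflexive (weigh-const 4 (A 1)))
        where
        at-front : ∀ c → c ∈ ⟨ I , O , O ⟩ → lookup (β p) c ≤ 4
        at-front 0F _ = β≤
        at-front 1F ()
        at-front 2F ()

-- The bound on the diameter

theorem1p6 : ∃ λ (C : ℕ) → ∀ (n δ : ℕ) (G : Graph n) → 1 ≤ δ → Connected G → Colorable 3 G → MinDegreeAtLeast G δ → ∀ u v → ∃ λ k → Walk G u v k × 23 * δ * k ≤ 57 * n + 23 * δ * C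
theorem1p6 = 4 , λ n δ G _ connected (col , proper) δ≤deg u v →
  let open Layers G connected col proper v in
  dist u , geodesic u , *-cancelˡ-≤ 13 (begin
    13 * (23 * δ * dist u)         ≡⟨ reorder₁ δ (dist u) ⟩
    23 * (δ * 13 * dist u)         ≤⟨ *-monoʳ-≤ 23 (distance-bound δ≤deg u) ⟩
    -- The slack comes from 13 · 57 - 23 · 32 = 5 for n and 23 · (13 · 4 - 41) = 253 for δ; the
    -- constant 4 is the least C with 41 ≤ 13 C.
    23 * (δ * 41 + 32 * n)         ≤⟨ m≤m+n _ (253 * δ + 5 * n) ⟩
    23 * (δ * 41 + 32 * n) + (253 * δ + 5 * n) ≡⟨ reorder₂ δ n ⟩
    13 * (57 * n + 23 * δ * 4)     ∎)
  where
  open ≤-Reasoning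
  reorder₁ : ∀ δ k → 13 * (23 * δ * k) ≡ 23 * (δ * 13 * k)
  reorder₁ = solve-∀
  reorder₂ : ∀ δ n → 23 * (δ * 41 + 32 * n) + (253 * δ + 5 * n) ≡ 13 * (57 * n + 23 * δ * 4)
  reorder₂ = solve-∀
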